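{- Let $n\ge 5$. Then the strong metric dimension of $L(n)$ is $n(n-2)$.
   Context: For $n\ge 5$, $H(n)$ is the graph with vertex set $V_1\cup V_2$, where $V_1=\{v_1,\dots,v_n\}$ and $V_2=\{v_iv_j: 1\le i<j\le n\}$, and $v_r$ is adjacent to $v_iv_j$ iff $r\in\{i,j\}$ (no other edges). $L(n)$ is the line graph of $H(n)$: its vertices are the edges of $H(n)$, two being adjacent iff they share an endpoint. A set $Q\subseteq V(G)$ is a strong resolving set of $G$ if for any two distinct vertices $p,q$ there is $s\in Q$ such that $p$ lies on some shortest $q$–$s$ path or $q$ lies on some shortest $p$–$s$ path; the strong metric dimension is the minimum size of a strong resolving set. -}

module Defs where

open import Data.Empty using (⊥)
open import Data.Fin.Base using (Fin; _<_)
open import Data.List.Base using (List; []; _∷_; length)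
import Data.List.Membership.Setoid as Membership
import Data.List.Relation.Unary.Unique.Setoid as Uniqueness
open import Data.Nat.Base using (ℕ; zero; suc; _≤_)
open import Data.Product.Base using (Σ; ∃-syntax; _×_; _,_)
open import Data.Sum.Base using (_⊎_; inj₁; inj₂)
open import Level using (0ℓ)
open import Relation.Binary.Bundles using (Setoid)
open import Relation.Binary.Core using (Rel)
open import Relation.Binary.Definitions using (Symmetric; Irreflexive; _Respects₂_)
open import Relation.Binary.PropositionalEquality.Core using (_≡_; refl; resp₂)
import Relation.Binary.PropositionalEquality.Properties as ≡
open import Relation.Nullary.Negation.Core using (¬_)

-- Simple graphs. The vertices form a setoid because the vertices of a line
-- graph are unordered pairs, which are represented here by ordered pairs up
-- to swapping.
record Graph : Set₁ where
  field
    vertices : Setoid 0ℓ 0ℓ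
  open Setoid vertices public
    renaming (Carrier to Vertex; refl to ≈-refl; sym to ≈-sym; trans to ≈-trans)
    using (_≈_)
  field
    Adj        : Rel Vertex 0ℓ
    Adj-resp-≈ : Adj Respects₂ _≈_
    Adj-sym    : Symmetric Adj
    Adj-irrefl : Irreflexive _≈_ Adj

module _ (G : Graph) where
  open Graph G

  record Edge : Set where
    constructor edge
    field
      end₁ end₂ : Vertex
      adjacent  : Adj end₁ end₂
  open Edge

  data SameEdge (e f : Edge) : Set where
    same    : end₁ e ≈ end₁ f → end₂ e ≈ end₂ f → SameEdge e f
    swapped : end₁ e ≈ end₂ f → end₂ e ≈ end₁ f → SameEdge e f

  SameEdge-refl : ∀ {e} → SameEdge e e
  SameEdge-refl = same ≈-refl ≈-refl

  SameEdge-sym : Symmetric SameEdge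
  SameEdge-sym (same p q)    = same (≈-sym p) (≈-sym q)
  SameEdge-sym (swapped p q) = swapped (≈-sym q) (≈-sym p)

  SameEdge-trans : ∀ {e f g} → SameEdge e f → SameEdge f g → SameEdge e g
  SameEdge-trans (same p q)    (same r s)    = same (≈-trans p r) (≈-trans q s)
  SameEdge-trans (same p q)    (swapped r s) = swapped (≈-trans p r) (≈-trans q s)
  SameEdge-trans (swapped p q) (same r s)    = swapped (≈-trans p s) (≈-trans q r)
  SameEdge-trans (swapped p q) (swapped r s) = same (≈-trans p s) (≈-trans q r)

  edgeSetoid : Setoid 0ℓ 0ℓ
  edgeSetoid = record
    { Carrier       = Edge
    ; _≈_           = SameEdge
    ; isEquivalence = record
      { refl  = SameEdge-refl
      ; sym   = SameEdge-sym
      ; trans = SameEdge-trans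
      }
    }

  IsEndpoint : Vertex → Edge → Set
  IsEndpoint w e = w ≈ end₁ e ⊎ w ≈ end₂ e

  IsEndpoint-resp : ∀ {w e f} → SameEdge e f → IsEndpoint w e → IsEndpoint w f
  IsEndpoint-resp (same p q)    (inj₁ r) = inj₁ (≈-trans r p)
  IsEndpoint-resp (same p q)    (inj₂ r) = inj₂ (≈-trans r q)
  IsEndpoint-resp (swapped p q) (inj₁ r) = inj₂ (≈-trans r p)
  IsEndpoint-resp (swapped p q) (inj₂ r) = inj₁ (≈-trans r q)

  LineAdj : Rel Edge 0ℓ
  LineAdj e f = ¬ SameEdge e f × (∃[ w ] (IsEndpoint w e × IsEndpoint w f))

  lineGraph : Graph
  lineGraph = record
    { vertices   = edgeSetoid
    ; Adj        = LineAdj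
    ; Adj-resp-≈ =
        (λ f≈g (e≉f , w , we , wf) →
          (λ e≈g → e≉f (SameEdge-trans e≈g (SameEdge-sym f≈g)))
          , w , we , IsEndpoint-resp f≈g wf)
      , (λ f≈g (f≉e , w , wf , we) →
          (λ g≈e → f≉e (SameEdge-trans f≈g g≈e))
          , w , IsEndpoint-resp f≈g wf , we)
    ; Adj-sym    = λ (e≉f , w , we , wf) → (λ f≈e → e≉f (SameEdge-sym f≈e)) , w , wf , we
    ; Adj-irrefl = λ e≈f (e≉f , _) → e≉f e≈f
    }

  infixr 5 _∷ʷ_

  data Walk : Vertex → Vertex → Set where
    stop : ∀ {p q} → p ≈ q → Walk p q
    _∷ʷ_ : ∀ {p q r} → Adj p q → Walk q r → Walk p r

  walkLength : ∀ {p q} → Walk p q → ℕ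
  walkLength (stop _) = zero
  walkLength (_ ∷ʷ w) = suc (walkLength w)

  visited : ∀ {p q} → Walk p q → List Vertex
  visited {p} (stop _) = p ∷ []
  visited {p} (_ ∷ʷ w) = p ∷ visited w

  open Membership vertices using (_∈_)
  open Uniqueness vertices using (Unique)

  IsPath : ∀ {p q} → Walk p q → Set
  IsPath w = Unique (visited w)

  IsShortestPath : ∀ {p q} → Walk p q → Set
  IsShortestPath {p} {q} w =
    IsPath w × (∀ (w′ : Walk p q) → IsPath w′ → walkLength w ≤ walkLength w′)

  LiesOnShortestPath : Vertex → Vertex → Vertex → Set
  LiesOnShortestPath p q s = Σ (Walk q s) λ w → IsShortestPath w × p ∈ visited w

  StronglyResolves : Vertex → Vertex → Vertex → Set
  StronglyResolves s p q = LiesOnShortestPath p q s ⊎ LiesOnShortestPath q p s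

  -- Finite sets of vertices are lists without repetitions (up to _≈_), so the
  -- size of such a set is the length of the list.
  IsStrongResolvingSet : List Vertex → Set
  IsStrongResolvingSet Q =
    Unique Q × (∀ p q → ¬ (p ≈ q) → ∃[ s ] (s ∈ Q × StronglyResolves s p q))

  StrongMetricDimension : ℕ → Set
  StrongMetricDimension k =
      (∃[ Q ] (IsStrongResolvingSet Q × length Q ≡ k))
    × (∀ Q → IsStrongResolvingSet Q → k ≤ length Q)

-- The proof of i < j is irrelevant, so a vertex of V₂ is determined by i and j.
data HVertex (n : ℕ) : Set where
  v  : Fin n → HVertex n
  vv : (i j : Fin n) → .(i < j) → HVertex n

HAdj : ∀ {n} → Rel (HVertex n) 0ℓ
HAdj (v _)      (v _)      = ⊥
HAdj (v r)      (vv i j _) = r ≡ i ⊎ r ≡ j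
HAdj (vv i j _) (v r)      = r ≡ i ⊎ r ≡ j
HAdj (vv _ _ _) (vv _ _ _) = ⊥

HAdj-sym : ∀ {n} → Symmetric (HAdj {n})
HAdj-sym {x = v _}      {vv _ _ _} a = a
HAdj-sym {x = vv _ _ _} {v _}      a = a

HAdj-irrefl : ∀ {n} → Irreflexive _≡_ (HAdj {n})
HAdj-irrefl {x = v _}      refl ()
HAdj-irrefl {x = vv _ _ _} refl ()

H : ℕ → Graph
H n = record
  { vertices   = ≡.setoid (HVertex n)
  ; Adj        = HAdj
  ; Adj-resp-≈ = resp₂ HAdj
  ; Adj-sym    = HAdj-sym
  ; Adj-irrefl = HAdj-irrefl
  }

L : ℕ → Graph
L n = lineGraph (H n)

{-# OPTIONS --safe #-}
module Submission where

-- An edge of H(n) joining v_a to v_a v_b is the dart a → b of K_n, and two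
-- darts are adjacent in L(n) iff they have the same tail or are reverses of
-- each other.  L(n) has diameter 3, and distinct darts with the same head are
-- at distance 3; such a pair is strongly resolved only by its own members.
-- So a strong resolving set misses at most one of the n − 1 darts into each
-- vertex and has at least n(n − 2) elements.  Conversely, missing exactly the
-- darts 0 → b and 1 → 0 leaves a strong resolving set.

open import Defs
open import Data.Fin.Base using (Fin; zero; suc; _<_; punchIn; punchOut)
open import Data.Fin.Properties
  using (_≟_; any?; <-cmp; <-irrefl; 0≢1+n; suc-injective; injective⇒≤;
         punchIn-injective; punchInᵢ≢i; punchIn-punchOut)
open import Data.List.Base using (List; []; _∷_; length; lookup; allFin; cartesianProductWith; map)
import Data.List.Membership.DecSetoid as DecMembership
import Data.List.Membership.Setoid as Membership
open import Data.List.Membership.Propositional.Properties using (∈-allFin)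
open import Data.List.Membership.Setoid.Properties
  using (∈-cartesianProductWith⁻; ∈-lookup; ∈-resp-≈; index-injective)
open import Data.List.Properties using (length-++; length-map; length-tabulate)
open import Data.List.Relation.Unary.All using ([])
open import Data.List.Relation.Unary.AllPairs using ([]; _∷_)
import Data.List.Relation.Unary.All.Properties as All
open import Data.List.Relation.Unary.Any using (here; there; index)
open import Data.List.Relation.Unary.Any.Properties using (cartesianProductWith⁺)
import Data.List.Relation.Unary.Unique.Propositional.Properties as Unique-≡
import Data.List.Relation.Unary.Unique.Setoid as Uniqueness
import Data.List.Relation.Unary.Unique.Setoid.Properties as Unique-≈
open import Data.Nat.Base using (ℕ; zero; suc; _+_; _*_; _∸_; _≤_; z≤n; s≤s; s≤s⁻¹)
open import Data.Nat.Properties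
  using (≤-refl; ≤-trans; ≤-reflexive; m≤n+m; +-monoˡ-≤; 1+n≰n)
open import Data.Product.Base using (Σ; ∃-syntax; _×_; _,_; proj₁; proj₂; map₂)
open import Data.Sum.Base using (_⊎_; inj₁; inj₂; fromInj₂; swap)
open import Function.Base using (_∘_; const; id)
open import Level using (0ℓ)
open import Relation.Binary.Bundles using (Setoid; DecSetoid)
open import Relation.Binary.Definitions using (tri<; tri≈; tri>)
open import Relation.Binary.PropositionalEquality
  using (_≡_; _≢_; refl; sym; trans; cong; cong₂; subst)
import Relation.Binary.PropositionalEquality.Properties as ≡
open import Relation.Nullary.Decidable using (Dec; yes; no; map′; _×-dec_; ¬?; decidable-stable)
open import Relation.Nullary.Negation using (¬_; contradiction; contradiction-irr)

-- Counting in lists without repetitions.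

length-cartesianProductWith : ∀ {A B C : Set} (f : A → B → C) xs ys →
  length (cartesianProductWith f xs ys) ≡ length xs * length ys
length-cartesianProductWith f []       ys = refl
length-cartesianProductWith f (x ∷ xs) ys = trans
  (length-++ (map (f x) ys))
  (cong₂ _+_ (length-map (f x) ys) (length-cartesianProductWith f xs ys))

module _ (S : Setoid 0ℓ 0ℓ) where
  open Setoid S using (_≈_) renaming (sym to ≈-sym)
  open Membership S using (_∈_)
  open Uniqueness S using (Unique)

  lookup-injective : ∀ {xs} → Unique xs → ∀ {i j} → lookup xs i ≈ lookup xs j → i ≡ j
  lookup-injective (_ ∷ _)   {zero}  {zero}  _  = refl
  lookup-injective (x∉ ∷ _)  {zero}  {suc j} eq =
    contradiction (∈-resp-≈ S (≈-sym eq) (∈-lookup S _ j)) (All.All¬⇒¬Any x∉)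
  lookup-injective (x∉ ∷ _)  {suc i} {zero}  eq =
    contradiction (∈-resp-≈ S eq (∈-lookup S _ i)) (All.All¬⇒¬Any x∉)
  lookup-injective (_ ∷ xs!) {suc i} {suc j} eq = cong suc (lookup-injective xs! eq)

  -- Sending each position of `xs` to a position in `ys` where its entry occurs is injective,
  -- because entries of `xs` at different positions differ.
  unique-⊆⇒length≤ : ∀ {xs ys} → Unique xs → (∀ {x} → x ∈ xs → x ∈ ys) → length xs ≤ length ys
  unique-⊆⇒length≤ {xs} xs! xs⊆ys = injective⇒≤ {f = λ i → index (xs⊆ys (∈-lookup S xs i))} λ eq →
    lookup-injective xs! (index-injective S (xs⊆ys (∈-lookup S xs _)) (xs⊆ys (∈-lookup S xs _)) eq)

-- Walks, geodesics and diametral pairs in an arbitrary graph.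

module _ (G : Graph) where
  open Graph G
  open Membership vertices using (_∈_)

  target∈visited : ∀ {p q} (w : Walk G p q) → q ∈ visited G w
  target∈visited (stop p≈q) = here (≈-sym p≈q)
  target∈visited (_ ∷ʷ w)   = there (target∈visited w)

  split : ∀ {p q r} (w : Walk G p q) → r ∈ visited G w →
          Σ (Walk G p r) λ w₁ → Σ (Walk G r q) λ w₂ →
            walkLength G w₁ + walkLength G w₂ ≡ walkLength G w
  split (stop p≈q) (here r≈p) = stop (≈-sym r≈p) , stop (≈-trans r≈p p≈q) , refl
  split (a ∷ʷ w)   (here r≈p) = stop (≈-sym r≈p) , proj₂ Adj-resp-≈ (≈-sym r≈p) a ∷ʷ w , refl
  split (a ∷ʷ w)   (there r∈w) with split w r∈w
  ... | w₁ , w₂ , eq = a ∷ʷ w₁ , w₂ , cong suc eq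

  -- Minimality among all walks, not only among paths, is what a lower bound on walk lengths gives
  -- directly; it already forces the walk to be a path.
  Geodesic : ∀ {p q} → Walk G p q → Set
  Geodesic {p} {q} w = ∀ (w′ : Walk G p q) → walkLength G w ≤ walkLength G w′

  -- If the first vertex recurred later, cutting out the loop would leave a strictly shorter walk
  -- with the same ends.
  geodesic⇒path : ∀ {p q} (w : Walk G p q) → Geodesic w → IsPath G w
  geodesic⇒path (stop _) _   = [] ∷ []
  geodesic⇒path (a ∷ʷ w) geo =
    All.¬Any⇒All¬ _ p∉w ∷ geodesic⇒path w λ w′ → s≤s⁻¹ (geo (a ∷ʷ w′))
    where
    p∉w : ¬ _ ∈ visited G w
    p∉w p∈w with split w p∈w
    ... | w₁ , w₂ , eq = 1+n≰n
      (≤-trans (geo w₂) (≤-trans (m≤n+m _ (walkLength G w₁)) (≤-reflexive eq)))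

  geodesic⇒shortest : ∀ {p q} (w : Walk G p q) → Geodesic w → IsShortestPath G w
  geodesic⇒shortest w geo = geodesic⇒path w geo , λ w′ _ → geo w′

  ¬≈⇒1≤ : ∀ {p q} → ¬ p ≈ q → (w : Walk G p q) → 1 ≤ walkLength G w
  ¬≈⇒1≤ p≉q (stop p≈q) = contradiction p≈q p≉q
  ¬≈⇒1≤ p≉q (_ ∷ʷ _)   = s≤s z≤n

  ¬Adj⇒2≤ : ∀ {p q} → ¬ p ≈ q → ¬ Adj p q → (w : Walk G p q) → 2 ≤ walkLength G w
  ¬Adj⇒2≤ p≉q ¬a (stop p≈q)      = contradiction p≈q p≉q
  ¬Adj⇒2≤ p≉q ¬a (a ∷ʷ stop r≈q) = contradiction (proj₁ Adj-resp-≈ r≈q a) ¬a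
  ¬Adj⇒2≤ p≉q ¬a (_ ∷ʷ _ ∷ʷ _)   = s≤s (s≤s z≤n)

  AtDistance≥3 : Vertex → Vertex → Set
  AtDistance≥3 p q = ∀ (w : Walk G p q) → 3 ≤ walkLength G w

  HasDiameter≤3 : Set
  HasDiameter≤3 = ∀ p q → Σ (Walk G p q) λ w → Geodesic w × walkLength G w ≤ 3

  -- If p were not s, a shortest q-s path through p would take at least 3 steps to reach p and at
  -- least one more after it, exceeding the diameter.
  diametral⇒endpoint : HasDiameter≤3 → ∀ {p q s} → AtDistance≥3 q p →
                       LiesOnShortestPath G p q s → p ≈ s
  diametral⇒endpoint diam {p} {q} {s} far (w , (_ , short) , p∈w)
    with diam q s | split w p∈w
  ... | w₃ , geo , ≤3 | w₁ , stop p≈s , _ = p≈s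
  ... | w₃ , geo , ≤3 | w₁ , a ∷ʷ w₂  , eq = contradiction
    (≤-trans (+-monoˡ-≤ (suc (walkLength G w₂)) (far w₁))
      (≤-trans (≤-reflexive eq) (≤-trans (short w₃ (geodesic⇒path w₃ geo)) ≤3)))
    λ { (s≤s (s≤s (s≤s ()))) }

  diametral-resolved⇒member : HasDiameter≤3 → ∀ {p q s} → AtDistance≥3 p q → AtDistance≥3 q p →
                              StronglyResolves G s p q → p ≈ s ⊎ q ≈ s
  diametral-resolved⇒member diam pq qp (inj₁ l) = inj₁ (diametral⇒endpoint diam qp l)
  diametral-resolved⇒member diam pq qp (inj₂ l) = inj₂ (diametral⇒endpoint diam pq l)

-- Edges of H(n) as darts

module _ {n : ℕ} where

  open Graph (L n) using (Adj)
    renaming (Vertex to Dart; _≈_ to _≋_; ≈-sym to ≋-sym; ≈-trans to ≋-trans; ≈-refl to ≋-refl)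

  tail : Dart → Fin n
  tail (edge (v r)      _     _) = r
  tail (edge (vv _ _ _) (v r) _) = r

  head : Dart → Fin n
  head (edge (v _)      (vv i j _) (inj₁ _)) = j
  head (edge (v _)      (vv i j _) (inj₂ _)) = i
  head (edge (vv i j _) (v _)      (inj₁ _)) = j
  head (edge (vv i j _) (v _)      (inj₂ _)) = i

  tail≢head : ∀ e → tail e ≢ head e
  tail≢head (edge (v _)        (vv i j i<j) (inj₁ refl)) eq = contradiction-irr i<j (<-irrefl eq)
  tail≢head (edge (v _)        (vv i j i<j) (inj₂ refl)) eq = contradiction-irr i<j (<-irrefl (sym eq))
  tail≢head (edge (vv i j i<j) (v _)        (inj₁ refl)) eq = contradiction-irr i<j (<-irrefl eq)
  tail≢head (edge (vv i j i<j) (v _)        (inj₂ refl)) eq = contradiction-irr i<j (<-irrefl (sym eq))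

  opaque
    -- Vertices in `V₂` carry increasing indices, so the ends of a dart have to be sorted first.
    -- Irrelevance of `a ≢ b` makes the vertex depend on a and b alone.
    pair : (a b : Fin n) → .(a ≢ b) → HVertex n
    pair a b a≢b with <-cmp a b
    ... | tri< a<b _ _ = vv a b a<b
    ... | tri≈ _ a≡b _ = contradiction-irr a≢b (λ a≢b → a≢b a≡b)
    ... | tri> _ _ b<a = vv b a b<a

    pair-< : ∀ {a b} .(a<b : a < b) .(a≢b : a ≢ b) → pair a b a≢b ≡ vv a b a<b
    pair-< {a} {b} a<b a≢b with <-cmp a b
    ... | tri< _ _ _    = refl
    ... | tri≈ ¬a<b _ _ = contradiction-irr a<b ¬a<b
    ... | tri> ¬a<b _ _ = contradiction-irr a<b ¬a<b

    pair-> : ∀ {a b} .(b<a : b < a) .(a≢b : a ≢ b) → pair a b a≢b ≡ vv b a b<a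
    pair-> {a} {b} b<a a≢b with <-cmp a b
    ... | tri< _ _ ¬b<a = contradiction-irr b<a ¬b<a
    ... | tri≈ _ _ ¬b<a = contradiction-irr b<a ¬b<a
    ... | tri> _ _ _    = refl

    pair-sym : ∀ a b .(a≢b : a ≢ b) .(b≢a : b ≢ a) → pair a b a≢b ≡ pair b a b≢a
    pair-sym a b a≢b b≢a with <-cmp a b
    ... | tri< a<b _ _ = sym (pair-> a<b b≢a)
    ... | tri≈ _ a≡b _ = contradiction-irr a≢b (λ a≢b → a≢b a≡b)
    ... | tri> _ _ b<a = sym (pair-< b<a b≢a)

    tail-pair : ∀ a b .(a≢b : a ≢ b) → HAdj (v a) (pair a b a≢b)
    tail-pair a b a≢b with <-cmp a b
    ... | tri< _ _ _   = inj₁ refl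
    ... | tri≈ _ a≡b _ = contradiction-irr a≢b (λ a≢b → a≢b a≡b)
    ... | tri> _ _ _   = inj₂ refl

  dart : (a b : Fin n) → .(a ≢ b) → Dart
  dart a b a≢b = edge (v a) (pair a b a≢b) (tail-pair a b a≢b)

  opaque
    unfolding pair tail-pair

    head-dart : ∀ a b .(a≢b : a ≢ b) → head (dart a b a≢b) ≡ b
    head-dart a b a≢b with <-cmp a b
    ... | tri< _ _ _   = refl
    ... | tri≈ _ a≡b _ = contradiction-irr a≢b (λ a≢b → a≢b a≡b)
    ... | tri> _ _ _   = refl

  -- The orientation in which an edge is stored only decides between `same` and `swapped`. This
  -- normal form is why tail and head together determine an edge.
  ≋-dart : ∀ e → e ≋ dart (tail e) (head e) (tail≢head e)
  ≋-dart (edge (v _)        (vv i j i<j) (inj₁ refl)) = same refl (sym (pair-< i<j _))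
  ≋-dart (edge (v _)        (vv i j i<j) (inj₂ refl)) = same refl (sym (pair-> i<j _))
  ≋-dart (edge (vv i j i<j) (v _)        (inj₁ refl)) = swapped (sym (pair-< i<j _)) refl
  ≋-dart (edge (vv i j i<j) (v _)        (inj₂ refl)) = swapped (sym (pair-> i<j _)) refl

  dart-cong : ∀ {a b a′ b′} .{a≢b : a ≢ b} .{a′≢b′ : a′ ≢ b′} →
              a ≡ a′ → b ≡ b′ → dart a b a≢b ≋ dart a′ b′ a′≢b′
  dart-cong refl refl = ≋-refl

  ≡⇒≋ : ∀ {e f} → tail e ≡ tail f → head e ≡ head f → e ≋ f
  ≡⇒≋ {e} {f} t h = ≋-trans (≋-dart e) (≋-trans (dart-cong t h) (≋-sym (≋-dart f)))

  tail-endpoint : ∀ e → IsEndpoint (H n) (v (tail e)) e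
  tail-endpoint (edge (v _)      (vv _ _ _) _) = inj₁ refl
  tail-endpoint (edge (vv _ _ _) (v _)      _) = inj₂ refl

  v-endpoint⇒tail : ∀ {r} e → IsEndpoint (H n) (v r) e → r ≡ tail e
  v-endpoint⇒tail (edge (v _)      (vv _ _ _) _) (inj₁ refl) = refl
  v-endpoint⇒tail (edge (vv _ _ _) (v _)      _) (inj₂ refl) = refl

  vv-endpoint⇒ends : ∀ {i j} .{i<j : i < j} e → IsEndpoint (H n) (vv i j i<j) e →
                     (tail e ≡ i × head e ≡ j) ⊎ (tail e ≡ j × head e ≡ i)
  vv-endpoint⇒ends (edge (v _)      (vv _ _ _) (inj₁ t)) (inj₂ refl) = inj₁ (t , refl)
  vv-endpoint⇒ends (edge (v _)      (vv _ _ _) (inj₂ t)) (inj₂ refl) = inj₂ (t , refl)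
  vv-endpoint⇒ends (edge (vv _ _ _) (v _)      (inj₁ t)) (inj₁ refl) = inj₁ (t , refl)
  vv-endpoint⇒ends (edge (vv _ _ _) (v _)      (inj₂ t)) (inj₁ refl) = inj₂ (t , refl)

  ≋⇒tail≡ : ∀ {e f} → e ≋ f → tail e ≡ tail f
  ≋⇒tail≡ {e} {f} e≋f = v-endpoint⇒tail f (IsEndpoint-resp (H n) e≋f (tail-endpoint e))

  ends-share : ∀ {i j} {e f : Dart} →
               (tail e ≡ i × head e ≡ j) ⊎ (tail e ≡ j × head e ≡ i) →
               (tail f ≡ i × head f ≡ j) ⊎ (tail f ≡ j × head f ≡ i) →
               (tail e ≡ tail f × head e ≡ head f) ⊎ (tail e ≡ head f × head e ≡ tail f)
  ends-share (inj₁ (a , b)) (inj₁ (c , d)) = inj₁ (trans a (sym c) , trans b (sym d))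
  ends-share (inj₁ (a , b)) (inj₂ (c , d)) = inj₂ (trans a (sym d) , trans b (sym c))
  ends-share (inj₂ (a , b)) (inj₁ (c , d)) = inj₂ (trans a (sym d) , trans b (sym c))
  ends-share (inj₂ (a , b)) (inj₂ (c , d)) = inj₁ (trans a (sym c) , trans b (sym d))

  shared-pair : ∀ {i j} .{i<j : i < j} e f →
    IsEndpoint (H n) (vv i j i<j) e → IsEndpoint (H n) (vv i j i<j) f →
    (tail e ≡ tail f × head e ≡ head f) ⊎ (tail e ≡ head f × head e ≡ tail f)
  shared-pair e f we wf = ends-share {e = e} {f} (vv-endpoint⇒ends e we) (vv-endpoint⇒ends f wf)

  pair-endpoint : ∀ e → IsEndpoint (H n) (pair (tail e) (head e) (tail≢head e)) e
  pair-endpoint e = IsEndpoint-resp (H n) (≋-sym (≋-dart e)) (inj₂ refl)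

  -- Equal edges share their `V₂` endpoint, so either their heads agree or they are reverses of each
  -- other; the latter is impossible since their tails agree.
  ≋⇒head≡ : ∀ {e f} → e ≋ f → head e ≡ head f
  ≋⇒head≡ {e} {f} e≋f
    -- Keeping `tail-pair` in the match leaves only the `vv` case, as two vertices in `V₁` are never
    -- adjacent.
    with pair (tail e) (head e) (tail≢head e)
       | tail-pair (tail e) (head e) (tail≢head e)
       | pair-endpoint e
  ... | vv _ _ _ | _ | we with shared-pair e f we (IsEndpoint-resp (H n) e≋f we)
  ...   | inj₁ (_ , h) = h
  ...   | inj₂ (t , _) = contradiction (trans (sym (≋⇒tail≡ e≋f)) t) (tail≢head f)

  _≋?_ : (e f : Dart) → Dec (e ≋ f)
  e ≋? f = map′ (λ (t , h) → ≡⇒≋ t h) (λ e≋f → ≋⇒tail≡ e≋f , ≋⇒head≡ e≋f)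
                ((tail e ≟ tail f) ×-dec (head e ≟ head f))

  dartDecSetoid : DecSetoid 0ℓ 0ℓ
  dartDecSetoid = record
    { Carrier          = Dart
    ; _≈_              = _≋_
    ; isDecEquivalence = record
      { isEquivalence = Setoid.isEquivalence (Graph.vertices (L n))
      ; _≟_           = _≋?_
      }
    }

  -- Adjacency and distance in L(n).

  Reverse : Dart → Dart → Set
  Reverse e f = tail e ≡ head f × head e ≡ tail f

  -- A shared endpoint in `V₁` is the tail of both darts. A shared endpoint in `V₂` fixes the
  -- unordered pair of ends, leaving the same dart or its reverse.
  adj⇒ : ∀ {e f} → Adj e f → tail e ≡ tail f ⊎ Reverse e f
  adj⇒ {e} {f} (_ , v _      , we , wf) = inj₁ (trans (sym (v-endpoint⇒tail e we)) (v-endpoint⇒tail f wf))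
  adj⇒ {e} {f} (_ , vv _ _ _ , we , wf) with shared-pair e f we wf
  ... | inj₁ (t , _) = inj₁ t
  ... | inj₂ rev     = inj₂ rev

  tail≡⇒adj : ∀ {e f} → tail e ≡ tail f → head e ≢ head f → Adj e f
  tail≡⇒adj {e} {f} t h = h ∘ ≋⇒head≡ , v (tail e) , tail-endpoint e ,
    subst (λ a → IsEndpoint (H n) (v a) f) (sym t) (tail-endpoint f)

  reverse⇒adj : ∀ {e f} → Reverse e f → Adj e f
  reverse⇒adj {e} {f} (t , h) =
      (λ e≋f → tail≢head f (trans (sym (≋⇒tail≡ e≋f)) t))
    , pair (tail e) (head e) (tail≢head e)
    , pair-endpoint e
    , subst (λ w → IsEndpoint (H n) w f) (sym (pair≡ t h)) (pair-endpoint f)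
    where
    pair≡ : ∀ {a b c d} .{a≢b : a ≢ b} .{c≢d : c ≢ d} → a ≡ d → b ≡ c → pair a b a≢b ≡ pair c d c≢d
    pair≡ refl refl = pair-sym _ _ _ _

  -- Equality of the two heads is deliberately allowed: pairs with a common head are the ones behind
  -- the lower bound.
  Far : Dart → Dart → Set
  Far e f = tail e ≢ tail f × head e ≢ tail f × tail e ≢ head f

  -- Each step keeps the tail or reverses the dart. Running through the combinations of at most two
  -- steps, the tail of f is the tail or the head of e, or the head of f is the tail of e.
  far⇒distance≥3 : ∀ {e f} → Far e f → AtDistance≥3 (L n) e f
  far⇒distance≥3 (tt , ht , th) (stop e≋f) = contradiction (≋⇒tail≡ e≋f) tt
  far⇒distance≥3 (tt , ht , th) (a ∷ʷ stop g≋f) with adj⇒ a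
  ... | inj₁ t       = contradiction (trans t (≋⇒tail≡ g≋f)) tt
  ... | inj₂ (_ , h) = contradiction (trans h (≋⇒tail≡ g≋f)) ht
  far⇒distance≥3 (tt , ht , th) (a ∷ʷ b ∷ʷ stop g≋f) with adj⇒ a | adj⇒ b
  ... | inj₁ t       | inj₁ t′       = contradiction (trans t (trans t′ (≋⇒tail≡ g≋f))) tt
  ... | inj₁ t       | inj₂ (t′ , _) = contradiction (trans t (trans t′ (≋⇒head≡ g≋f))) th
  ... | inj₂ (_ , h) | inj₁ t′       = contradiction (trans h (trans t′ (≋⇒tail≡ g≋f))) ht
  ... | inj₂ (t , _) | inj₂ (_ , h′) = contradiction (trans t (trans h′ (≋⇒tail≡ g≋f))) tt
  far⇒distance≥3 _ (_ ∷ʷ _ ∷ʷ _ ∷ʷ _) = s≤s (s≤s (s≤s z≤n))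

  -- For a ≠ c, the walk a → b, a → c, c → a, c → d joins the first dart to the last. Its first step
  -- is dropped when b = c and its last step when a = d; what remains is geodesic.
  diameter≤3 : HasDiameter≤3 (L n)
  diameter≤3 e f with e ≋? f
  ... | yes e≋f = stop e≋f , (λ _ → z≤n) , z≤n
  ... | no e≉f with tail e ≟ tail f
  ...   | yes t = tail≡⇒adj t (e≉f ∘ ≡⇒≋ t) ∷ʷ stop ≋-refl , ¬≈⇒1≤ (L n) e≉f , s≤s z≤n
  ...   | no t≢ with head e ≟ tail f | tail e ≟ head f
  ...     | yes ht | yes th = reverse⇒adj (th , ht) ∷ʷ stop ≋-refl , ¬≈⇒1≤ (L n) e≉f , s≤s z≤n
  ...     | yes ht | no  t≢h =
              reverse⇒adj {e} {m} (sym (head-dart _ _ _) , ht) ∷ʷ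
              tail≡⇒adj {m} {f} refl (λ eq → t≢h (trans (sym (head-dart _ _ _)) eq)) ∷ʷ stop ≋-refl
            , ¬Adj⇒2≤ (L n) e≉f ¬adj , s≤s (s≤s z≤n)
            where
            m = dart (tail f) (tail e) (t≢ ∘ sym)
            ¬adj : ¬ Adj e f
            ¬adj a with adj⇒ a
            ... | inj₁ t       = t≢ t
            ... | inj₂ (t , _) = t≢h t
  ...     | no h≢t | yes th =
              tail≡⇒adj {e} {m} refl (λ eq → h≢t (trans eq (head-dart _ _ _))) ∷ʷ
              reverse⇒adj {m} {f} (th , head-dart _ _ _) ∷ʷ stop ≋-refl
            , ¬Adj⇒2≤ (L n) e≉f ¬adj , s≤s (s≤s z≤n)
            where
            m = dart (tail e) (tail f) t≢
            ¬adj : ¬ Adj e f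
            ¬adj a with adj⇒ a
            ... | inj₁ t       = t≢ t
            ... | inj₂ (_ , h) = h≢t h
  ...     | no h≢t | no t≢h =
              tail≡⇒adj {e} {m} refl (λ eq → h≢t (trans eq (head-dart _ _ _))) ∷ʷ
              reverse⇒adj {m} {m′} (sym (head-dart _ _ _) , head-dart _ _ _) ∷ʷ
              tail≡⇒adj {m′} {f} refl (λ eq → t≢h (trans (sym (head-dart _ _ _)) eq)) ∷ʷ stop ≋-refl
            , far⇒distance≥3 (t≢ , h≢t , t≢h) , ≤-refl
            where
            m  = dart (tail e) (tail f) t≢
            m′ = dart (tail f) (tail e) (t≢ ∘ sym)

  -- A vertex lies at the end of every shortest path towards itself.
  memberResolvesˡ : ∀ p q → StronglyResolves (L n) p p q
  memberResolvesˡ p q with diameter≤3 q p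
  ... | w , geo , _ = inj₁ (w , geodesic⇒shortest (L n) w geo , target∈visited (L n) w)

  memberResolvesʳ : ∀ p q → StronglyResolves (L n) q p q
  memberResolvesʳ p q = swap (memberResolvesˡ q p)

-- Sets of darts missing one dart into each vertex

module _ {m : ℕ} where

  open Graph (L (2 + m)) using ()
    renaming (Vertex to Dart; _≈_ to _≋_; vertices to darts; ≈-sym to ≋-sym)
  open DecMembership (dartDecSetoid {2 + m}) using (_∈_; _∈?_)
  open Uniqueness darts using (Unique)

  -- `punchIn b` skips b, so k runs over the n - 1 possible tails, where n = 2 + m.
  into : (b : Fin (2 + m)) → Fin (1 + m) → Dart
  into b k = dart (punchIn b k) b (punchInᵢ≢i b k)

  head-into : ∀ b k → head (into b k) ≡ b
  head-into b k = head-dart _ _ _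

  into-far : ∀ b {k l} → k ≢ l → Far (into b k) (into b l)
  into-far b {k} {l} k≢l =
      k≢l ∘ punchIn-injective b k l
    , (λ eq → punchInᵢ≢i b l (trans (sym eq) (head-into b k)))
    , (λ eq → punchInᵢ≢i b k (trans eq (head-into b l)))

  tail-punchIn : ∀ (e : Dart) → ∃[ k ] tail e ≡ punchIn (head e) k
  tail-punchIn e = punchOut (tail≢head e ∘ sym) , sym (punchIn-punchOut (tail≢head e ∘ sym))

  -- `x b` is the index of the dart into b that is left out. The inner `punchIn` skips it, which
  -- leaves m = n - 2 darts for each head.
  omitting : (Fin (2 + m) → Fin (1 + m)) → List Dart
  omitting x = cartesianProductWith (λ b j → into b (punchIn (x b) j)) (allFin (2 + m)) (allFin m)

  length-omitting : ∀ x → length (omitting x) ≡ (2 + m) * m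
  length-omitting x = trans (length-cartesianProductWith _ (allFin (2 + m)) (allFin m))
    (cong₂ _*_ (length-tabulate {n = 2 + m} id) (length-tabulate {n = m} id))

  into-injective : ∀ {b c k l} → into b k ≋ into c l → b ≡ c × punchIn b k ≡ punchIn c l
  into-injective {b} {c} {k} {l} eq =
    trans (sym (head-into b k)) (trans (≋⇒head≡ eq) (head-into c l)) , ≋⇒tail≡ eq

  omitting-unique : ∀ x → Unique (omitting x)
  omitting-unique x = Unique-≈.cartesianProductWith⁺ (≡.setoid _) (≡.setoid _) darts _ inj
    (Unique-≡.allFin⁺ _) (Unique-≡.allFin⁺ _)
    where
    inj : ∀ {b c j k} → into b (punchIn (x b) j) ≋ into c (punchIn (x c) k) → b ≡ c × j ≡ k
    inj {b} {c} {j} {k} eq with into-injective {b} {c} {punchIn (x b) j} {punchIn (x c) k} eq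
    ... | refl , t = refl , punchIn-injective (x b) j k (punchIn-injective b _ _ t)

  ∈-omitting : ∀ x {e k} → tail e ≡ punchIn (head e) k → x (head e) ≢ k → e ∈ omitting x
  ∈-omitting x {e} {k} t x≢k = cartesianProductWith⁺ _
    (λ { refl refl → ≡⇒≋ (trans t (cong (punchIn (head e)) (sym (punchIn-punchOut x≢k))))
                         (sym (head-into (head e) _)) })
    (∈-allFin (head e)) (∈-allFin (punchOut x≢k))

  lower-bound : ∀ Q → IsStrongResolvingSet (L (2 + m)) Q → (2 + m) * m ≤ length Q
  lower-bound Q (_ , resolving) = subst (_≤ length Q) (length-omitting x)
    (unique-⊆⇒length≤ darts (omitting-unique x) omitting⊆Q)
    where
    -- Two darts into b are at distance 3, so whatever resolves them is one of the two.
    one-of : ∀ b {k l} → k ≢ l → into b k ∈ Q ⊎ into b l ∈ Q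
    one-of b {k} {l} k≢l with resolving (into b k) (into b l) (k≢l ∘ punchIn-injective b k l ∘ ≋⇒tail≡)
    ... | s , s∈Q , res with diametral-resolved⇒member (L (2 + m)) diameter≤3
                               (far⇒distance≥3 (into-far b k≢l)) (far⇒distance≥3 (into-far b (k≢l ∘ sym))) res
    ...   | inj₁ eq = inj₁ (∈-resp-≈ darts (≋-sym eq) s∈Q)
    ...   | inj₂ eq = inj₂ (∈-resp-≈ darts (≋-sym eq) s∈Q)

    missing : ∀ b → ∃[ k ] ∀ l → k ≢ l → into b l ∈ Q
    missing b with any? (λ k → ¬? (into b k ∈? Q))
    -- If Q contains every dart into b, any index can play the omitted one; `zero` is a default.
    ... | no all∈ = zero , λ l _ → decidable-stable (into b l ∈? Q) (λ l∉ → all∈ (l , l∉))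
    ... | yes (k , k∉) = k , λ l k≢l → fromInj₂ (λ k∈ → contradiction k∈ k∉) (one-of b k≢l)

    x : Fin (2 + m) → Fin (1 + m)
    x b = proj₁ (missing b)

    omitting⊆Q : ∀ {e} → e ∈ omitting x → e ∈ Q
    omitting⊆Q e∈ with ∈-cartesianProductWith⁻ (≡.setoid _) (≡.setoid _) darts
                         (λ b j → into b (punchIn (x b) j)) (allFin _) (allFin _) e∈
    ... | b , j , _ , _ , e≋ = ∈-resp-≈ darts (≋-sym e≋)
      (proj₂ (missing b) (punchIn (x b) j) (punchInᵢ≢i (x b) j ∘ sym))

-- A strong resolving set of size n(n - 2).

module _ {m : ℕ} where

  private
    n = 3 + m
    G = L n

  open Graph G using ()
    renaming (Vertex to Dart; _≈_ to _≋_; vertices to darts; ≈-refl to ≋-refl)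
  open Membership darts using (_∈_)

  -- The dart omitted into b is punchIn b zero → b; punchIn b zero is 0 if b is
  -- nonzero and 1 if b is 0.
  basis : List Dart
  basis = omitting (const zero)

  -- For p = 0 → b and q = 0 → c with c ≥ 2, the resolver is s = c → 0: the walk p, q, s is shortest
  -- since p and s have different tails and are not reverses.
  resolve-out-of-0 : ∀ p q {y} → tail p ≡ zero → tail q ≡ zero →
    head q ≡ suc (suc y) → head p ≢ head q →
    ∃[ s ] (s ∈ basis × LiesOnShortestPath G q p s)
  resolve-out-of-0 p q {y} tp tq hq h≢ =
    -- Among the darts into 0 the tail c = y + 2 has index y + 1, which is not the omitted index 0.
    s , ∈-omitting (const zero) {s} {suc y} (trans hq (cong (λ h → punchIn h (suc y)) (sym hs))) 0≢1+n
      , p→q→s , geodesic⇒shortest G p→q→s (¬Adj⇒2≤ G p≉s ¬adj) , there (here ≋-refl)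
    where
    s = dart (head q) (tail q) (tail≢head q ∘ sym)

    hs : head s ≡ zero
    hs = trans (head-dart _ _ _) tq

    p→q→s : Walk G p s
    p→q→s = tail≡⇒adj {e = p} {q} (trans tp (sym tq)) h≢ ∷ʷ
            reverse⇒adj {e = q} {s} (sym (head-dart _ _ _) , refl) ∷ʷ stop ≋-refl

    tp≢ts : tail p ≢ tail s
    tp≢ts eq = 0≢1+n (trans (sym tp) (trans eq hq))

    p≉s : ¬ p ≋ s
    p≉s = tp≢ts ∘ ≋⇒tail≡

    ¬adj : ¬ Graph.Adj G p s
    ¬adj a with adj⇒ a
    ... | inj₁ t       = tp≢ts t
    ... | inj₂ (_ , h) = h≢ h

  -- For p = 0 → b and q = 1 → 0 the resolver is s = 1 → 2. If b = 1, then p is the reverse of q and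
  -- p, q, s is shortest; otherwise p, 0 → 1, q, s is, as p and s are then `Far`.
  resolve-1→0 : ∀ p q {x} → tail p ≡ zero → head p ≡ suc x →
    tail q ≡ suc zero → head q ≡ zero →
    ∃[ s ] (s ∈ basis × LiesOnShortestPath G q p s)
  resolve-1→0 p q {x} tp hp tq hq =
    -- The dart omitted into 2 is 0 → 2; the tail 1 has index 1 and is kept.
    s , ∈-omitting (const zero) {s} {suc zero} (cong (λ h → punchIn h (suc zero)) (sym hs)) 0≢1+n
      , path x hp
    where
    s = dart (suc zero) (suc (suc zero)) λ ()

    hs : head s ≡ suc (suc zero)
    hs = head-dart _ _ _

    tp≢ts : tail p ≢ tail s
    tp≢ts eq = 0≢1+n (trans (sym tp) eq)

    tp≢hs : tail p ≢ head s
    tp≢hs eq = 0≢1+n (trans (sym tp) (trans eq hs))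

    q→s : Graph.Adj G q s
    q→s = tail≡⇒adj {e = q} {s} tq (λ eq → 0≢1+n (trans (sym hq) (trans eq hs)))

    path : ∀ x → head p ≡ suc x → LiesOnShortestPath G q p s
    path zero hp = w , geodesic⇒shortest G w (¬Adj⇒2≤ G (tp≢ts ∘ ≋⇒tail≡) ¬adj) , there (here ≋-refl)
      where
      w : Walk G p s
      w = reverse⇒adj {e = p} {q} (trans tp (sym hq) , trans hp (sym tq)) ∷ʷ q→s ∷ʷ stop ≋-refl

      ¬adj : ¬ Graph.Adj G p s
      ¬adj a with adj⇒ a
      ... | inj₁ t       = tp≢ts t
      ... | inj₂ (t , _) = tp≢hs t
    path (suc x) hp = w , geodesic⇒shortest G w (far⇒distance≥3 (tp≢ts , hp≢1 , tp≢hs))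
                        , there (there (here ≋-refl))
      where
      r = dart zero (suc zero) 0≢1+n

      hp≢1 : head p ≢ suc zero
      hp≢1 eq = 0≢1+n (suc-injective (trans (sym eq) hp))

      w : Walk G p s
      w = tail≡⇒adj {e = p} {r} tp (λ eq → hp≢1 (trans eq (head-dart _ _ _))) ∷ʷ
          reverse⇒adj {e = r} {q} (sym hq , trans (head-dart _ _ _) (sym tq)) ∷ʷ
          q→s ∷ʷ stop ≋-refl

  -- Either exactly one of the two darts is 1 → 0, or both leave 0; in the latter case their heads
  -- differ, so at least one head is 2 or more.
  resolve-omitted : ∀ p q → ¬ p ≋ q →
    tail p ≡ punchIn (head p) zero → tail q ≡ punchIn (head q) zero →
    ∃[ s ] (s ∈ basis × StronglyResolves G s p q)
  resolve-omitted p q p≉q tp tq with head p in hp | head q in hq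
  ... | zero  | zero  = contradiction (≡⇒≋ (trans tp (sym tq)) (trans hp (sym hq))) p≉q
  ... | suc _ | zero  = map₂ (map₂ inj₂) (resolve-1→0 p q tp hp tq hq)
  ... | zero  | suc _ = map₂ (map₂ inj₁) (resolve-1→0 q p tq hq tp hp)
  ... | suc _ | suc (suc _) =
    map₂ (map₂ inj₂) (resolve-out-of-0 p q tp tq hq (p≉q ∘ ≡⇒≋ (trans tp (sym tq))))
  -- Here only the head of p is at least 2, so p becomes the middle vertex of the path.
  ... | suc (suc _) | suc zero =
    map₂ (map₂ inj₁) (resolve-out-of-0 q p tq tp hp (p≉q ∘ ≡⇒≋ (trans tp (sym tq)) ∘ sym))
  ... | suc zero | suc zero = contradiction (≡⇒≋ (trans tp (sym tq)) (trans hp (sym hq))) p≉q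

  upper-bound : IsStrongResolvingSet G basis
  upper-bound = omitting-unique (const zero) , resolve
    where
    resolve : ∀ p q → ¬ p ≋ q → ∃[ s ] (s ∈ basis × StronglyResolves G s p q)
    resolve p q p≉q with tail-punchIn p | tail-punchIn q
    -- A nonzero index means that the dart is kept, and then it resolves the pair itself.
    ... | suc _ , t | _         = p , ∈-omitting (const zero) {p} t 0≢1+n , memberResolvesˡ p q
    ... | zero , _  | suc _ , t = q , ∈-omitting (const zero) {q} t 0≢1+n , memberResolvesʳ p q
    ... | zero , tp | zero , tq = resolve-omitted p q p≉q tp tq

theorem3p10 : (n : ℕ) → 5 ≤ n → StrongMetricDimension (L n) (n * (n ∸ 2))
theorem3p10 (suc zero)          (s≤s ())
theorem3p10 (suc (suc zero))    (s≤s (s≤s ()))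
-- For n = 3 + m the product computes to (3 + m) * (1 + m), which is the count in `length-omitting`
-- at `suc m`.
theorem3p10 (suc (suc (suc m))) _ =
  (basis , upper-bound , length-omitting {m = suc m} (const zero)) , lower-bound {m = suc m}
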